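{- Let $(M_n)_{n\in\mathbb N}$ be a sequence of EPCF programs such that $M_n\to_{\mathtt{wh}}M_{n+1}$ for all $n$. Then for every $i\in\mathbb N$ there exists $j>i$ such that $M_i\twoheadrightarrow_{\mathtt{wh}}M_j$ and $M_i^{\downarrow}\to_{\mathsf{PCF}}M_j^{\downarrow}$.
   Context: PCF terms: $P::=x\mid \lambda x.P\mid P\cdot Q\mid \mathbf{fix}\,P\mid \mathbf{0}\mid \mathbf{pred}\,P\mid \mathbf{succ}\,P\mid \mathbf{ifz}(P,Q,Q')$, up to $\alpha$-conversion, $\underline n=\mathbf{succ}^n(\mathbf 0)$. PCF evaluation contexts $E::=\square\mid E\cdot P\mid\mathbf{pred}\,E\mid\mathbf{succ}\,E\mid\mathbf{ifz}(E,P,Q)$; $\to_{\mathsf{PCF}}$: $E[(\lambda x.P)Q]\to E[P\{Q/x\}]$, $E[\mathbf{fix}\,P]\to E[P\cdot\mathbf{fix}\,P]$, $E[\mathbf{pred}(\mathbf{succ}\,\underline n)]\to E[\underline n]$, $E[\mathbf{pred}\,\mathbf 0]\to E[\mathbf 0]$, $E[\mathbf{ifz}(\mathbf 0,P_1,P_2)]\to E[P_1]$, $E[\mathbf{ifz}(\underline{n+1},P_1,P_2)]\to E[P_2]$. EPCF terms add explicit substitutions $M\langle N/x\rangle$ ($x$ bound in $M$). For $\sigma=\langle N_1/x_1\rangle\cdots\langle N_n/x_n\rangle$ ($x_i$ distinct), $M^\sigma=(\cdots(M\langle N_1/x_1\rangle)\cdots)\langle N_n/x_n\rangle$, $\sigma(x_i)=N_i$.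 An EPCF program is a closed EPCF term all of whose subterms $M\langle N/x\rangle$ have $N$ closed. $\to_{\mathtt{wh}}$ is the union of: computation steps $E[(\lambda x.M)^\sigma N]\to E[M^\sigma\langle N/x\rangle]$, $E[\mathbf{pred}\,\mathbf 0]\to E[\mathbf 0]$, $E[\mathbf{pred}\,\underline{n+1}]\to E[\underline n]$, $E[\mathbf{ifz}(\mathbf 0,M,N)]\to E[M]$, $E[\mathbf{ifz}(\underline{n+1},M,N)]\to E[N]$, $E[\mathbf{fix}\,M]\to E[M(\mathbf{fix}\,M)]$; and percolation steps (σ nonempty) $E[x^\sigma]\to E[N]$ if $\sigma(x)=N$, $E[y^\sigma]\to E[y]$ if $y\notin\mathrm{dom}\sigma$, $E[\mathbf 0^\sigma]\to E[\mathbf 0]$, $E[(M\cdot N)^\sigma]\to E[M^\sigma\cdot N^\sigma]$, $E[(\mathbf{pred}\,M)^\sigma]\to E[\mathbf{pred}(M^\sigma)]$, $E[(\mathbf{succ}\,M)^\sigma]\to E[\mathbf{succ}(M^\sigma)]$, $E[\mathbf{ifz}(L,M,N)^\sigma]\to E[\mathbf{ifz}(L^\sigma,M^\sigma,N^\sigma)]$, $E[(\mathbf{fix}\,M)^\sigma]\to E[\mathbf{fix}(M^\sigma)]$ (EPCF evaluation contexts as for PCF). $\twoheadrightarrow_{\mathtt{wh}}$ reflexive-transitive closure. The collapse $M^\downarrow$ performs all explicit substitutions: it commutes with all PCF constructors and $(M\langle N/x\rangle)^\downarrow=M^\downarrow\{N^\downarrow/x\}$. -}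

module Defs where

open import Data.Nat using (ℕ; zero; suc)
open import Data.Fin using (Fin; zero; suc; fromℕ; inject₁)
open import Data.Vec using (Vec; []; _∷_; lookup; _∷ʳ_)
open import Relation.Binary.Construct.Closure.ReflexiveTransitive using (Star)

data PTm (n : ℕ) : Set where
  pvar  : Fin n → PTm n
  plam  : PTm (suc n) → PTm n
  _·ₚ_  : PTm n → PTm n → PTm n
  pfix  : PTm n → PTm n
  pzero : PTm n
  ppred : PTm n → PTm n
  psucc : PTm n → PTm n
  pifz  : PTm n → PTm n → PTm n → PTm n

pnum : ∀ {n} → ℕ → PTm n
pnum zero    = pzero
pnum (suc k) = psucc (pnum k)

Ren : ℕ → ℕ → Set
Ren m n = Fin m → Fin n

extR : ∀ {m n} → Ren m n → Ren (suc m) (suc n)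
extR ρ zero    = zero
extR ρ (suc i) = suc (ρ i)

prename : ∀ {m n} → Ren m n → PTm m → PTm n
prename ρ (pvar i)     = pvar (ρ i)
prename ρ (plam P)     = plam (prename (extR ρ) P)
prename ρ (P ·ₚ Q)     = prename ρ P ·ₚ prename ρ Q
prename ρ (pfix P)     = pfix (prename ρ P)
prename ρ pzero        = pzero
prename ρ (ppred P)    = ppred (prename ρ P)
prename ρ (psucc P)    = psucc (prename ρ P)
prename ρ (pifz P Q R) = pifz (prename ρ P) (prename ρ Q) (prename ρ R)

PSub : ℕ → ℕ → Set
PSub m n = Fin m → PTm n

extS : ∀ {m n} → PSub m n → PSub (suc m) (suc n)
extS s zero    = pvar zero
extS s (suc i) = prename suc (s i)

psubst : ∀ {m n} → PSub m n → PTm m → PTm n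
psubst s (pvar i)     = s i
psubst s (plam P)     = plam (psubst (extS s) P)
psubst s (P ·ₚ Q)     = psubst s P ·ₚ psubst s Q
psubst s (pfix P)     = pfix (psubst s P)
psubst s pzero        = pzero
psubst s (ppred P)    = ppred (psubst s P)
psubst s (psucc P)    = psucc (psubst s P)
psubst s (pifz P Q R) = pifz (psubst s P) (psubst s Q) (psubst s R)

single : ∀ {n} → PTm n → PSub (suc n) n
single Q zero    = Q
single Q (suc i) = pvar i

_[_]ₚ : ∀ {n} → PTm (suc n) → PTm n → PTm n
P [ Q ]ₚ = psubst (single Q) P

data PCtx : Set where
  □      : PCtx
  _·E_   : PCtx → PTm 0 → PCtx
  predE  : PCtx → PCtx
  succE  : PCtx → PCtx
  ifzE   : PCtx → PTm 0 → PTm 0 → PCtx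

pplug : PCtx → PTm 0 → PTm 0
pplug □              P = P
pplug (E ·E Q)       P = pplug E P ·ₚ Q
pplug (predE E)      P = ppred (pplug E P)
pplug (succE E)      P = psucc (pplug E P)
pplug (ifzE E Q R)   P = pifz (pplug E P) Q R

data _↦ₚ_ : PTm 0 → PTm 0 → Set where
  β      : ∀ P Q → (plam P ·ₚ Q) ↦ₚ (P [ Q ]ₚ)
  fixβ   : ∀ P → pfix P ↦ₚ (P ·ₚ pfix P)
  predS  : ∀ k → ppred (psucc (pnum k)) ↦ₚ pnum k
  predZ  : ppred pzero ↦ₚ pzero
  ifzZ   : ∀ P₁ P₂ → pifz pzero P₁ P₂ ↦ₚ P₁
  ifzS   : ∀ k P₁ P₂ → pifz (pnum (suc k)) P₁ P₂ ↦ₚ P₂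

data _→PCF_ : PTm 0 → PTm 0 → Set where
  ctx : ∀ (E : PCtx) {P Q} → P ↦ₚ Q → pplug E P →PCF pplug E Q

-- Explicit substitution  M⟨N/x⟩  binds x (index 0) in M.
-- Only the subterms needed for programs are represented: the substituted
-- term N is required to be closed (N : Tm 0).  Hence the EPCF programs
-- are exactly the inhabitants of  Tm 0.

data Tm (n : ℕ) : Set where
  var  : Fin n → Tm n
  lam  : Tm (suc n) → Tm n
  _·_  : Tm n → Tm n → Tm n
  fix  : Tm n → Tm n
  zer  : Tm n
  pred : Tm n → Tm n
  succ : Tm n → Tm n
  ifz  : Tm n → Tm n → Tm n → Tm n
  _⟨_⟩ : Tm (suc n) → Tm 0 → Tm n

Program : Set
Program = Tm 0

num : ∀ {n} → ℕ → Tm n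
num zero    = zer
num (suc k) = succ (num k)

rename : ∀ {m n} → Ren m n → Tm m → Tm n
rename ρ (var i)     = var (ρ i)
rename ρ (lam M)     = lam (rename (extR ρ) M)
rename ρ (M · N)     = rename ρ M · rename ρ N
rename ρ (fix M)     = fix (rename ρ M)
rename ρ zer         = zer
rename ρ (pred M)    = pred (rename ρ M)
rename ρ (succ M)    = succ (rename ρ M)
rename ρ (ifz L M N) = ifz (rename ρ L) (rename ρ M) (rename ρ N)
rename ρ (M ⟨ N ⟩)   = rename (extR ρ) M ⟨ N ⟩

-- M^σ for σ = ⟨N₁/x₁⟩⋯⟨N_k/x_k⟩ (all Nᵢ closed), represented by the vector
-- N₁ ∷ ⋯ ∷ N_k ∷ [];  M^σ = (⋯(M⟨N₁/x₁⟩)⋯)⟨N_k/x_k⟩.  In M, x₁ (innermost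
-- binder) has index 0, …, x_k has index k-1; so σ(xᵢ) = lookup σ i.
_^_ : ∀ {k} → Tm k → Vec (Tm 0) k → Tm 0
M ^ []      = M
M ^ (N ∷ σ) = (M ⟨ N ⟩) ^ σ

-- In  (λx.M)^σ , inside M the variable x has index 0 and xᵢ index i.
-- In  M^σ⟨N/x⟩ = (⋯(M⟨N₁/x₁⟩)⋯⟨N_k/x_k⟩)⟨N/x⟩  the binder of x is outermost,
-- so M is reindexed by the rotation below and the result is  M' ^ (σ ∷ʳ N).
rot : ∀ {k} → Ren (suc k) (suc k)
rot {k} zero    = fromℕ k
rot     (suc i) = inject₁ i

data Ctx : Set where
  □      : Ctx
  _·E_   : Ctx → Tm 0 → Ctx
  predE  : Ctx → Ctx
  succE  : Ctx → Ctx
  ifzE   : Ctx → Tm 0 → Tm 0 → Ctx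

plug : Ctx → Tm 0 → Tm 0
plug □            M = M
plug (E ·E N)     M = plug E M · N
plug (predE E)    M = pred (plug E M)
plug (succE E)    M = succ (plug E M)
plug (ifzE E N L) M = ifz (plug E M) N L

-- head rules of →wh (computation and percolation steps) on programs.
-- The percolation rule  y^σ → y  (y ∉ dom σ) cannot fire on a closed
-- redex, so it does not appear.
data _↦wh_ : Tm 0 → Tm 0 → Set where
  β     : ∀ {k} (M : Tm (suc k)) (σ : Vec (Tm 0) k) (N : Tm 0) →
          ((lam M ^ σ) · N) ↦wh (rename rot M ^ (σ ∷ʳ N))
  predZ : pred zer ↦wh zer
  predS : ∀ k → pred (num (suc k)) ↦wh num k
  ifzZ  : ∀ M N → ifz zer M N ↦wh M
  ifzS  : ∀ k M N → ifz (num (suc k)) M N ↦wh N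
  fixβ  : ∀ M → fix M ↦wh (M · fix M)
  pvar  : ∀ {k} (σ : Vec (Tm 0) (suc k)) (i : Fin (suc k)) →
          (var i ^ σ) ↦wh lookup σ i
  pzer  : ∀ {k} (σ : Vec (Tm 0) (suc k)) → (zer ^ σ) ↦wh zer
  papp  : ∀ {k} (σ : Vec (Tm 0) (suc k)) M N →
          ((M · N) ^ σ) ↦wh ((M ^ σ) · (N ^ σ))
  ppred : ∀ {k} (σ : Vec (Tm 0) (suc k)) M →
          (pred M ^ σ) ↦wh pred (M ^ σ)
  psucc : ∀ {k} (σ : Vec (Tm 0) (suc k)) M →
          (succ M ^ σ) ↦wh succ (M ^ σ)
  pifz  : ∀ {k} (σ : Vec (Tm 0) (suc k)) L M N →
          (ifz L M N ^ σ) ↦wh ifz (L ^ σ) (M ^ σ) (N ^ σ)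
  pfix  : ∀ {k} (σ : Vec (Tm 0) (suc k)) M →
          (fix M ^ σ) ↦wh fix (M ^ σ)

data _→wh_ : Tm 0 → Tm 0 → Set where
  ctx : ∀ (E : Ctx) {M N} → M ↦wh N → plug E M →wh plug E N

_↠wh_ : Tm 0 → Tm 0 → Set
_↠wh_ = Star _→wh_

_↓ : ∀ {n} → Tm n → PTm n
var i ↓       = pvar i
lam M ↓       = plam (M ↓)
(M · N) ↓     = (M ↓) ·ₚ (N ↓)
fix M ↓       = pfix (M ↓)
zer ↓         = pzero
pred M ↓      = ppred (M ↓)
succ M ↓      = psucc (M ↓)
ifz L M N ↓   = pifz (L ↓) (M ↓) (N ↓)
(M ⟨ N ⟩) ↓   = (M ↓) [ prename (λ ()) (N ↓) ]ₚ

-- Every weak-head step of a program either collapses to a PCF step (the computation steps)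
-- or leaves the collapse unchanged (the percolation steps).  Percolation steps alone cannot go
-- on forever: they strictly decrease a size in which an explicit substitution doubles the
-- weight of its body.  So from any point of an infinite reduction sequence, a run of
-- percolation steps is eventually followed by a computation step, and the collapse of the
-- whole segment is that single PCF step.

module Submission where

open import Defs
open import Data.Nat using (ℕ; zero; suc; _+_; _*_; _<_; z≤n; s≤s) renaming (_^_ to _^ℕ_)
open import Data.Nat.Properties
open import Data.Nat.Induction using (<-wellFounded)
open import Data.Fin using (Fin; zero; suc; fromℕ; inject₁)
open import Data.Vec using (Vec; []; _∷_; lookup; map; _∷ʳ_)
open import Data.Vec.Properties using (lookup-map)
open import Data.Vec.Functional using () renaming (_∷_ to _∷ₛ_)
open import Data.Product using (∃-syntax; _×_; _,_)
open import Function using (_∘_)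
open import Induction.WellFounded using (Acc; acc)
open import Relation.Binary.PropositionalEquality
open import Relation.Binary.Construct.Closure.ReflexiveTransitive using (ε; _◅_)

cong₃ : ∀ {A B C D : Set} (f : A → B → C → D) {a a′ b b′ c c′} →
  a ≡ a′ → b ≡ b′ → c ≡ c′ → f a b c ≡ f a′ b′ c′
cong₃ f refl refl refl = refl

-- Renaming and substitution of PCF terms

prename-cong : ∀ {m n} {ρ ρ′ : Ren m n} → (∀ i → ρ i ≡ ρ′ i) →
  ∀ P → prename ρ P ≡ prename ρ′ P
prename-cong h (pvar i)     = cong pvar (h i)
prename-cong h (plam P)     = cong plam (prename-cong h′ P)
  where h′ : ∀ i → extR _ i ≡ extR _ i
        h′ zero    = refl
        h′ (suc i) = cong suc (h i)
prename-cong h (P ·ₚ Q)     = cong₂ _·ₚ_ (prename-cong h P) (prename-cong h Q)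
prename-cong h (pfix P)     = cong pfix (prename-cong h P)
prename-cong h pzero        = refl
prename-cong h (ppred P)    = cong ppred (prename-cong h P)
prename-cong h (psucc P)    = cong psucc (prename-cong h P)
prename-cong h (pifz P Q R) = cong₃ pifz (prename-cong h P) (prename-cong h Q) (prename-cong h R)

prename-prename : ∀ {l m n} {ρ : Ren m n} {ρ′ : Ren l m} {ρ″ : Ren l n} →
  (∀ i → ρ (ρ′ i) ≡ ρ″ i) → ∀ P → prename ρ (prename ρ′ P) ≡ prename ρ″ P
prename-prename h (pvar i)     = cong pvar (h i)
prename-prename h (plam P)     = cong plam (prename-prename h′ P)
  where h′ : ∀ i → extR _ (extR _ i) ≡ extR _ i
        h′ zero    = refl
        h′ (suc i) = cong suc (h i)
prename-prename h (P ·ₚ Q)     = cong₂ _·ₚ_ (prename-prename h P) (prename-prename h Q)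
prename-prename h (pfix P)     = cong pfix (prename-prename h P)
prename-prename h pzero        = refl
prename-prename h (ppred P)    = cong ppred (prename-prename h P)
prename-prename h (psucc P)    = cong psucc (prename-prename h P)
prename-prename h (pifz P Q R) =
  cong₃ pifz (prename-prename h P) (prename-prename h Q) (prename-prename h R)

psubst-prename : ∀ {l m n} {s : PSub m n} {ρ : Ren l m} {t : PSub l n} →
  (∀ i → s (ρ i) ≡ t i) → ∀ P → psubst s (prename ρ P) ≡ psubst t P
psubst-prename h (pvar i)     = h i
psubst-prename h (plam P)     = cong plam (psubst-prename h′ P)
  where h′ : ∀ i → extS _ (extR _ i) ≡ extS _ i
        h′ zero    = refl
        h′ (suc i) = cong (prename suc) (h i)
psubst-prename h (P ·ₚ Q)     = cong₂ _·ₚ_ (psubst-prename h P) (psubst-prename h Q)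
psubst-prename h (pfix P)     = cong pfix (psubst-prename h P)
psubst-prename h pzero        = refl
psubst-prename h (ppred P)    = cong ppred (psubst-prename h P)
psubst-prename h (psucc P)    = cong psucc (psubst-prename h P)
psubst-prename h (pifz P Q R) =
  cong₃ pifz (psubst-prename h P) (psubst-prename h Q) (psubst-prename h R)

prename-psubst : ∀ {l m n} {ρ : Ren m n} {s : PSub l m} {t : PSub l n} →
  (∀ i → prename ρ (s i) ≡ t i) → ∀ P → prename ρ (psubst s P) ≡ psubst t P
prename-psubst h (pvar i)     = h i
prename-psubst {ρ = ρ} {s} {t} h (plam P) = cong plam (prename-psubst h′ P)
  where h′ : ∀ i → prename (extR ρ) (extS s i) ≡ extS t i
        h′ zero    = refl
        h′ (suc i) = begin
          prename (extR ρ) (prename suc (s i)) ≡⟨ prename-prename (λ _ → refl) (s i) ⟩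
          prename (suc ∘ ρ) (s i)              ≡⟨ prename-prename (λ _ → refl) (s i) ⟨
          prename suc (prename ρ (s i))        ≡⟨ cong (prename suc) (h i) ⟩
          prename suc (t i)                    ∎
          where open ≡-Reasoning
prename-psubst h (P ·ₚ Q)     = cong₂ _·ₚ_ (prename-psubst h P) (prename-psubst h Q)
prename-psubst h (pfix P)     = cong pfix (prename-psubst h P)
prename-psubst h pzero        = refl
prename-psubst h (ppred P)    = cong ppred (prename-psubst h P)
prename-psubst h (psucc P)    = cong psucc (prename-psubst h P)
prename-psubst h (pifz P Q R) =
  cong₃ pifz (prename-psubst h P) (prename-psubst h Q) (prename-psubst h R)

psubst-psubst : ∀ {l m n} {s : PSub m n} {t : PSub l m} {u : PSub l n} →
  (∀ i → psubst s (t i) ≡ u i) → ∀ P → psubst s (psubst t P) ≡ psubst u P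
psubst-psubst h (pvar i)     = h i
psubst-psubst {s = s} {t} {u} h (plam P) = cong plam (psubst-psubst h′ P)
  where h′ : ∀ i → psubst (extS s) (extS t i) ≡ extS u i
        h′ zero    = refl
        h′ (suc i) = begin
          psubst (extS s) (prename suc (t i)) ≡⟨ psubst-prename (λ _ → refl) (t i) ⟩
          psubst (prename suc ∘ s) (t i)      ≡⟨ prename-psubst (λ _ → refl) (t i) ⟨
          prename suc (psubst s (t i))        ≡⟨ cong (prename suc) (h i) ⟩
          prename suc (u i)                   ∎
          where open ≡-Reasoning
psubst-psubst h (P ·ₚ Q)     = cong₂ _·ₚ_ (psubst-psubst h P) (psubst-psubst h Q)
psubst-psubst h (pfix P)     = cong pfix (psubst-psubst h P)
psubst-psubst h pzero        = refl
psubst-psubst h (ppred P)    = cong ppred (psubst-psubst h P)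
psubst-psubst h (psucc P)    = cong psucc (psubst-psubst h P)
psubst-psubst h (pifz P Q R) =
  cong₃ pifz (psubst-psubst h P) (psubst-psubst h Q) (psubst-psubst h R)

psubst-id : ∀ {n} {s : PSub n n} → (∀ i → s i ≡ pvar i) → ∀ P → psubst s P ≡ P
psubst-id h (pvar i)     = h i
psubst-id h (plam P)     = cong plam (psubst-id h′ P)
  where h′ : ∀ i → extS _ i ≡ pvar i
        h′ zero    = refl
        h′ (suc i) = cong (prename suc) (h i)
psubst-id h (P ·ₚ Q)     = cong₂ _·ₚ_ (psubst-id h P) (psubst-id h Q)
psubst-id h (pfix P)     = cong pfix (psubst-id h P)
psubst-id h pzero        = refl
psubst-id h (ppred P)    = cong ppred (psubst-id h P)
psubst-id h (psucc P)    = cong psucc (psubst-id h P)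
psubst-id h (pifz P Q R) = cong₃ pifz (psubst-id h P) (psubst-id h Q) (psubst-id h R)

prename-[]ₚ : ∀ {m n} (ρ : Ren m n) P Q →
  prename ρ (P [ Q ]ₚ) ≡ prename (extR ρ) P [ prename ρ Q ]ₚ
prename-[]ₚ ρ P Q = trans (prename-psubst {t = u} h P) (sym (psubst-prename h′ P))
  where
    u : PSub (suc _) _
    u = prename ρ Q ∷ₛ (pvar ∘ ρ)
    h : ∀ i → prename ρ (single Q i) ≡ u i
    h zero    = refl
    h (suc i) = refl
    h′ : ∀ i → single (prename ρ Q) (extR ρ i) ≡ u i
    h′ zero    = refl
    h′ (suc i) = refl

prename-suc-[]ₚ : ∀ {n} (P : PTm n) Q → prename suc P [ Q ]ₚ ≡ P
prename-suc-[]ₚ P Q = trans (psubst-prename (λ _ → refl) P) (psubst-id (λ _ → refl) P)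

psubst-extS-[]ₚ : ∀ {m n} (s : PSub m n) P Q → psubst (extS s) P [ Q ]ₚ ≡ psubst (Q ∷ₛ s) P
psubst-extS-[]ₚ s P Q = psubst-psubst h P
  where h : ∀ i → extS s i [ Q ]ₚ ≡ (Q ∷ₛ s) i
        h zero    = refl
        h (suc i) = prename-suc-[]ₚ (s i) Q

weaken : ∀ {n} → PTm 0 → PTm n
weaken = prename (λ ())

prename-weaken : ∀ {m n} (ρ : Ren m n) P → prename ρ (weaken P) ≡ weaken P
prename-weaken ρ = prename-prename (λ ())

psubst-weaken : ∀ {n} (s : PSub n 0) P → psubst s (weaken P) ≡ P
psubst-weaken s P = trans (psubst-prename {t = pvar} (λ ()) P) (psubst-id (λ ()) P)

-- The collapse

-- Defs weakens the substituend with its own absurd renaming; any two agree.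
↓-⟨⟩ : ∀ {n} (M : Tm (suc n)) N → (M ⟨ N ⟩) ↓ ≡ M ↓ [ weaken (N ↓) ]ₚ
↓-⟨⟩ M N = cong (M ↓ [_]ₚ) (prename-cong (λ ()) (N ↓))

↓-rename : ∀ {m n} (ρ : Ren m n) (M : Tm m) → rename ρ M ↓ ≡ prename ρ (M ↓)
↓-rename ρ (var i)     = refl
↓-rename ρ (lam M)     = cong plam (↓-rename (extR ρ) M)
↓-rename ρ (M · N)     = cong₂ _·ₚ_ (↓-rename ρ M) (↓-rename ρ N)
↓-rename ρ (fix M)     = cong pfix (↓-rename ρ M)
↓-rename ρ zer         = refl
↓-rename ρ (pred M)    = cong ppred (↓-rename ρ M)
↓-rename ρ (succ M)    = cong psucc (↓-rename ρ M)
↓-rename ρ (ifz L M N) = cong₃ pifz (↓-rename ρ L) (↓-rename ρ M) (↓-rename ρ N)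
↓-rename ρ (M ⟨ N ⟩)   = begin
  (rename (extR ρ) M ⟨ N ⟩) ↓               ≡⟨ ↓-⟨⟩ (rename (extR ρ) M) N ⟩
  rename (extR ρ) M ↓ [ weaken (N ↓) ]ₚ     ≡⟨ cong (_[ weaken (N ↓) ]ₚ) (↓-rename (extR ρ) M) ⟩
  prename (extR ρ) (M ↓) [ weaken (N ↓) ]ₚ  ≡⟨ cong (prename (extR ρ) (M ↓) [_]ₚ)
                                                    (prename-weaken ρ (N ↓)) ⟨
  prename (extR ρ) (M ↓) [ prename ρ (weaken (N ↓)) ]ₚ ≡⟨ prename-[]ₚ ρ (M ↓) (weaken (N ↓)) ⟨
  prename ρ (M ↓ [ weaken (N ↓) ]ₚ)         ≡⟨ cong (prename ρ) (↓-⟨⟩ M N) ⟨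
  prename ρ ((M ⟨ N ⟩) ↓)                   ∎
  where open ≡-Reasoning

_↓ˢ : ∀ {k} → Vec Program k → PSub k 0
(σ ↓ˢ) i = lookup σ i ↓

↓-^ : ∀ {k} (M : Tm k) (σ : Vec Program k) → (M ^ σ) ↓ ≡ psubst (σ ↓ˢ) (M ↓)
↓-^ M []      = sym (psubst-id (λ ()) (M ↓))
↓-^ M (N ∷ σ) = begin
  ((M ⟨ N ⟩) ^ σ) ↓                          ≡⟨ ↓-^ (M ⟨ N ⟩) σ ⟩
  psubst (σ ↓ˢ) ((M ⟨ N ⟩) ↓)                ≡⟨ cong (psubst (σ ↓ˢ)) (↓-⟨⟩ M N) ⟩
  psubst (σ ↓ˢ) (M ↓ [ weaken (N ↓) ]ₚ)      ≡⟨ psubst-psubst h (M ↓) ⟩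
  psubst ((N ∷ σ) ↓ˢ) (M ↓)                  ∎
  where
    open ≡-Reasoning
    h : ∀ i → psubst (σ ↓ˢ) (single (weaken (N ↓)) i) ≡ ((N ∷ σ) ↓ˢ) i
    h zero    = psubst-weaken (σ ↓ˢ) (N ↓)
    h (suc i) = refl

lookup-∷ʳ-fromℕ : ∀ {A : Set} {k} (σ : Vec A k) x → lookup (σ ∷ʳ x) (fromℕ k) ≡ x
lookup-∷ʳ-fromℕ []      x = refl
lookup-∷ʳ-fromℕ (_ ∷ σ) x = lookup-∷ʳ-fromℕ σ x

lookup-∷ʳ-inject₁ : ∀ {A : Set} {k} (σ : Vec A k) x i → lookup (σ ∷ʳ x) (inject₁ i) ≡ lookup σ i
lookup-∷ʳ-inject₁ (_ ∷ σ) x zero    = refl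
lookup-∷ʳ-inject₁ (_ ∷ σ) x (suc i) = lookup-∷ʳ-inject₁ σ x i

↓-β : ∀ {k} (M : Tm (suc k)) (σ : Vec Program k) N →
  (rename rot M ^ (σ ∷ʳ N)) ↓ ≡ psubst (extS (σ ↓ˢ)) (M ↓) [ N ↓ ]ₚ
↓-β M σ N = begin
  (rename rot M ^ (σ ∷ʳ N)) ↓                   ≡⟨ ↓-^ (rename rot M) (σ ∷ʳ N) ⟩
  psubst ((σ ∷ʳ N) ↓ˢ) (rename rot M ↓)          ≡⟨ cong (psubst _) (↓-rename rot M) ⟩
  psubst ((σ ∷ʳ N) ↓ˢ) (prename rot (M ↓))       ≡⟨ psubst-prename h (M ↓) ⟩
  psubst (N ↓ ∷ₛ σ ↓ˢ) (M ↓)                     ≡⟨ psubst-extS-[]ₚ (σ ↓ˢ) (M ↓) (N ↓) ⟨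
  psubst (extS (σ ↓ˢ)) (M ↓) [ N ↓ ]ₚ            ∎
  where
    open ≡-Reasoning
    h : ∀ i → ((σ ∷ʳ N) ↓ˢ) (rot i) ≡ (N ↓ ∷ₛ σ ↓ˢ) i
    h zero    = cong _↓ (lookup-∷ʳ-fromℕ σ N)
    h (suc i) = cong _↓ (lookup-∷ʳ-inject₁ σ N i)

↓-num : ∀ k → num {0} k ↓ ≡ pnum k
↓-num zero    = refl
↓-num (suc k) = cong psucc (↓-num k)

_↓ᶜ : Ctx → PCtx
□ ↓ᶜ            = □
(E ·E N) ↓ᶜ     = (E ↓ᶜ) ·E (N ↓)
predE E ↓ᶜ      = predE (E ↓ᶜ)
succE E ↓ᶜ      = succE (E ↓ᶜ)
ifzE E N L ↓ᶜ   = ifzE (E ↓ᶜ) (N ↓) (L ↓)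

↓-plug : ∀ E M → plug E M ↓ ≡ pplug (E ↓ᶜ) (M ↓)
↓-plug □            M = refl
↓-plug (E ·E N)     M = cong (_·ₚ (N ↓)) (↓-plug E M)
↓-plug (predE E)    M = cong ppred (↓-plug E M)
↓-plug (succE E)    M = cong psucc (↓-plug E M)
↓-plug (ifzE E N L) M = cong (λ P → pifz P (N ↓) (L ↓)) (↓-plug E M)

-- A size decreased by percolation steps

-- A variable weighs one more than the term σ substitutes for it, and an explicit
-- substitution doubles the weight of its body; pushing σ one constructor inwards,
-- which copies σ, then makes the term strictly lighter.
size : ∀ {n} → Vec ℕ n → Tm n → ℕ
size w (var i)     = lookup w i
size w (lam M)     = suc (size (0 ∷ w) M)
size w (M · N)     = suc (size w M + size w N)
size w (fix M)     = suc (size w M)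
size w zer         = 1
size w (pred M)    = suc (size w M)
size w (succ M)    = suc (size w M)
size w (ifz L M N) = suc (size w L + size w M + size w N)
size w (M ⟨ N ⟩)   = 2 * size (suc (size [] N) ∷ w) M

μ : Program → ℕ
μ = size []

weights : ∀ {k} → Vec Program k → Vec ℕ k
weights = map (suc ∘ μ)

μ-^ : ∀ {k} (M : Tm k) (σ : Vec Program k) → μ (M ^ σ) ≡ 2 ^ℕ k * size (weights σ) M
μ-^ M []              = sym (*-identityˡ (μ M))
μ-^ {suc k} M (N ∷ σ) = begin
  μ ((M ⟨ N ⟩) ^ σ)  ≡⟨ μ-^ (M ⟨ N ⟩) σ ⟩
  2 ^ℕ k * (2 * x)    ≡⟨ *-assoc (2 ^ℕ k) 2 x ⟨
  2 ^ℕ k * 2 * x      ≡⟨ cong (_* x) (*-comm (2 ^ℕ k) 2) ⟩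
  2 * 2 ^ℕ k * x      ∎
  where
    open ≡-Reasoning
    x = size (weights (N ∷ σ)) M

1<2^[1+k] : ∀ k → 1 < 2 ^ℕ suc k
1<2^[1+k] k = ^-monoʳ-< 2 (s≤s (s≤s z≤n)) {0} {suc k} (s≤s z≤n)

1+m*n<m*[1+n] : ∀ {m} n → 1 < m → suc (m * n) < m * suc n
1+m*n<m*[1+n] {m} n 1<m = begin-strict
  suc (m * n) <⟨ +-monoˡ-< (m * n) 1<m ⟩
  m + m * n   ≡⟨ *-suc m n ⟨
  m * suc n   ∎
  where open ≤-Reasoning

n<m*[1+n] : ∀ {m} n → 1 < m → n < m * suc n
n<m*[1+n] {m} n 1<m = begin-strict
  n           <⟨ n<1+n n ⟩
  suc n       <⟨ m<m*n (suc n) m 1<m ⟩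
  suc n * m   ≡⟨ *-comm (suc n) m ⟩
  m * suc n   ∎
  where open ≤-Reasoning

percolation-< : ∀ k {a b} n → a ≡ 2 ^ℕ suc k * suc n → b ≡ suc (2 ^ℕ suc k * n) → b < a
percolation-< k n a≡ b≡ = subst₂ _<_ (sym b≡) (sym a≡) (1+m*n<m*[1+n] n (1<2^[1+k] k))

μ-lookup-< : ∀ {k} (σ : Vec Program (suc k)) i → μ (lookup σ i) < μ (var i ^ σ)
μ-lookup-< {k} σ i = begin-strict
  μ (lookup σ i)                      <⟨ n<m*[1+n] (μ (lookup σ i)) (1<2^[1+k] k) ⟩
  2 ^ℕ suc k * suc (μ (lookup σ i))   ≡⟨ cong (2 ^ℕ suc k *_) (lookup-map i (suc ∘ μ) σ) ⟨
  2 ^ℕ suc k * lookup (weights σ) i   ≡⟨ μ-^ (var i) σ ⟨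
  μ (var i ^ σ)                       ∎
  where open ≤-Reasoning

μ-·-< : ∀ {k} (σ : Vec Program (suc k)) M N → μ ((M ^ σ) · (N ^ σ)) < μ ((M · N) ^ σ)
μ-·-< {k} σ M N = percolation-< k (a + b) (μ-^ (M · N) σ) (cong suc (begin
  μ (M ^ σ) + μ (N ^ σ)  ≡⟨ cong₂ _+_ (μ-^ M σ) (μ-^ N σ) ⟩
  d * a + d * b          ≡⟨ *-distribˡ-+ d a b ⟨
  d * (a + b)            ∎))
  where
    open ≡-Reasoning
    d = 2 ^ℕ suc k
    a = size (weights σ) M
    b = size (weights σ) N

μ-ifz-< : ∀ {k} (σ : Vec Program (suc k)) L M N →
  μ (ifz (L ^ σ) (M ^ σ) (N ^ σ)) < μ (ifz L M N ^ σ)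
μ-ifz-< {k} σ L M N = percolation-< k (a + b + c) (μ-^ (ifz L M N) σ) (cong suc (begin
  μ (L ^ σ) + μ (M ^ σ) + μ (N ^ σ)  ≡⟨ cong₂ _+_ (cong₂ _+_ (μ-^ L σ) (μ-^ M σ)) (μ-^ N σ) ⟩
  d * a + d * b + d * c              ≡⟨ cong (_+ d * c) (*-distribˡ-+ d a b) ⟨
  d * (a + b) + d * c                ≡⟨ *-distribˡ-+ d (a + b) c ⟨
  d * (a + b + c)                    ∎))
  where
    open ≡-Reasoning
    d = 2 ^ℕ suc k
    a = size (weights σ) L
    b = size (weights σ) M
    c = size (weights σ) N

-- Simulation of weak-head steps in PCF

data Simulated (_⇒_ : PTm 0 → PTm 0 → Set) (A B : Program) : Set where
  percolation : A ↓ ≡ B ↓ → μ B < μ A → Simulated _⇒_ A B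
  computation : (A ↓) ⇒ (B ↓) → Simulated _⇒_ A B

simulate-head : ∀ {A B} → A ↦wh B → Simulated _↦ₚ_ A B
simulate-head (β M σ N) = computation (subst₂ _↦ₚ_
  (sym (cong (_·ₚ (N ↓)) (↓-^ (lam M) σ))) (sym (↓-β M σ N))
  (β (psubst (extS (σ ↓ˢ)) (M ↓)) (N ↓)))
simulate-head predZ        = computation predZ
simulate-head (predS k)    = computation (subst₂ _↦ₚ_
  (cong (λ P → ppred (psucc P)) (sym (↓-num k))) (sym (↓-num k)) (predS k))
simulate-head (ifzZ M N)   = computation (ifzZ (M ↓) (N ↓))
simulate-head (ifzS k M N) = computation (subst (λ P → pifz (psucc P) (M ↓) (N ↓) ↦ₚ (N ↓))
  (sym (↓-num k)) (ifzS k (M ↓) (N ↓)))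
simulate-head (fixβ M)     = computation (fixβ (M ↓))
simulate-head (pvar σ i) = percolation (↓-^ (var i) σ) (μ-lookup-< σ i)
simulate-head (pzer {k} σ) = percolation (↓-^ zer σ)
  (subst (1 <_) (sym (trans (μ-^ zer σ) (*-identityʳ (2 ^ℕ suc k)))) (1<2^[1+k] k))
simulate-head (papp σ M N) = percolation
  (trans (↓-^ (M · N) σ) (sym (cong₂ _·ₚ_ (↓-^ M σ) (↓-^ N σ))))
  (μ-·-< σ M N)
simulate-head (ppred {k} σ M) = percolation
  (trans (↓-^ (pred M) σ) (sym (cong ppred (↓-^ M σ))))
  (percolation-< k _ (μ-^ (pred M) σ) (cong suc (μ-^ M σ)))
simulate-head (psucc {k} σ M) = percolation
  (trans (↓-^ (succ M) σ) (sym (cong psucc (↓-^ M σ))))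
  (percolation-< k _ (μ-^ (succ M) σ) (cong suc (μ-^ M σ)))
simulate-head (pfix {k} σ M) = percolation
  (trans (↓-^ (fix M) σ) (sym (cong pfix (↓-^ M σ))))
  (percolation-< k _ (μ-^ (fix M) σ) (cong suc (μ-^ M σ)))
simulate-head (pifz σ L M N) = percolation
  (trans (↓-^ (ifz L M N) σ) (sym (cong₃ pifz (↓-^ L σ) (↓-^ M σ) (↓-^ N σ))))
  (μ-ifz-< σ L M N)

plug-μ-< : ∀ E {A B} → μ B < μ A → μ (plug E B) < μ (plug E A)
plug-μ-< □            lt = lt
plug-μ-< (E ·E N)     lt = s≤s (+-monoˡ-< (μ N) (plug-μ-< E lt))
plug-μ-< (predE E)    lt = s≤s (plug-μ-< E lt)
plug-μ-< (succE E)    lt = s≤s (plug-μ-< E lt)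
plug-μ-< (ifzE E N L) lt = s≤s (+-monoˡ-< (μ L) (+-monoˡ-< (μ N) (plug-μ-< E lt)))

simulate : ∀ {A B} → A →wh B → Simulated _→PCF_ A B
simulate (ctx E {M} {N} r) with simulate-head r
... | percolation same lt = percolation
  (trans (↓-plug E M) (trans (cong (pplug (E ↓ᶜ)) same) (sym (↓-plug E N))))
  (plug-μ-< E lt)
... | computation s = computation
  (subst₂ _→PCF_ (sym (↓-plug E M)) (sym (↓-plug E N)) (ctx (E ↓ᶜ) s))

pcf-step-ahead : (M : ℕ → Program) → (∀ n → M n →wh M (suc n)) →
  ∀ i → Acc _<_ (μ (M i)) → ∃[ j ] (i < j × M i ↠wh M j × (M i ↓) →PCF (M j ↓))
pcf-step-ahead M steps i (acc lighter) with simulate (steps i)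
... | computation p = suc i , n<1+n i , steps i ◅ ε , p
... | percolation same lt with pcf-step-ahead M steps (suc i) (lighter lt)
...   | j , i+1<j , reduces , p =
  j , <-trans (n<1+n i) i+1<j , steps i ◅ reduces , subst (_→PCF (M j ↓)) (sym same) p

proposition2p22 : (M : ℕ → Program) → (∀ n → M n →wh M (suc n)) →
    ∀ i → ∃[ j ] (i < j × M i ↠wh M j × (M i ↓) →PCF (M j ↓))
proposition2p22 M steps i = pcf-step-ahead M steps i (<-wellFounded (μ (M i)))
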